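{- Let $C=\langle A,G\rangle$ be a contract over a fixed vector of typed state variables $\vec{s}$ and a fixed vector of typed input variables $\vec{i}$, with assumption $A=\langle A_I,A_T\rangle$ and guarantee $G=\langle G_I,G_T\rangle$. Then $C$ is realizable if and only if \[ \forall \vec{i}.\; A_I[\vec{i}] \Rightarrow \exists \vec{s}.\; \big(G_I[\vec{s},\vec{i}] \land \mathit{Viable}_C(\vec{s})\big). \]
   Context: Fix a vector $\vec{s}$ of typed state variables and a vector $\vec{i}$ of typed input variables; a state is a type-consistent valuation of $\vec{s}$ and an input is a type-consistent valuation of $\vec{i}$. Primed vectors $\vec{s}',\vec{i}'$ denote renamed copies used for next-step values. Predicates are formulas over the indicated variables, interpreted as relations on valuations. A transition system $S=\langle \vec{s},\vec{i},I,T\rangle$ consists of an initial predicate $I[\vec{s},\vec{i}]$ and a transition predicate $T[\vec{s},\vec{i}',\vec{s}']$. A contract is a pair $C=\langle A,G\rangle$ with: - an assumption $A=\langle A_I,A_T\rangle$, where $A_I[\vec{i}]$ is a predicate over the inputs and $A_T[\vec{s},\vec{i}']$ is a predicate over the current state and the next inputs; - a guarantee $G=\langle G_I,G_T\rangle$, where $G_I[\vec{s},\vec{i}]$ and $G_T[\vec{s},\vec{i}',\vec{s}']$ are predicates. In particular, $G$ is itself a transition system with the same state and input variables. Reachable states under an assumption: for a transition system $S=\langle \vec{s},\vec{i},I,T\rangle$ and an assumption $A$, the set $\mathit{Reachable}_{S,A}$ is the least set of states such that: - every state $\vec{s}$ for which there is an input $\vec{i}_0$ with $A_I[\vec{i}_0]\land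 I[\vec{s},\vec{i}_0]$ belongs to it; and - whenever $\vec{s}_p\in\mathit{Reachable}_{S,A}$ and $A_T[\vec{s}_p,\vec{i}']\land T[\vec{s}_p,\vec{i}',\vec{s}]$ hold, then $\vec{s}\in\mathit{Reachable}_{S,A}$. $S$ satisfies $C$ if both of the following hold: 1. $\forall\vec{s},\vec{i}.\; A_I[\vec{i}]\land I[\vec{s},\vec{i}]\Rightarrow G_I[\vec{s},\vec{i}]$; 2. $\forall \vec{s},\vec{i}',\vec{s}'.\; \mathit{Reachable}_{S,A}(\vec{s})\land A_T[\vec{s},\vec{i}']\land T[\vec{s},\vec{i}',\vec{s}']\Rightarrow G_T[\vec{s},\vec{i}',\vec{s}']$. $S$ is input-enabled under $A$ if both of the following hold: 1. $\forall\vec{i}.\; A_I[\vec{i}]\Rightarrow\exists\vec{s}.\, I[\vec{s},\vec{i}]$; 2. $\forall\vec{s},\vec{i}'.\; \mathit{Reachable}_{S,A}(\vec{s})\land A_T[\vec{s},\vec{i}']\Rightarrow\exists\vec{s}'.\,T[\vec{s},\vec{i}',\vec{s}']$. $S$ is a realization of $C$ if $S$ satisfies $C$ and is input-enabled under $A$. The contract $C$ is realizable if there exists a transition system over the same state variables $\vec{s}$ and input variables $\vec{i}$ that is a realization of $C$. Viable states: $\mathit{Viable}_C$ is the greatest (coinductively defined) set of states satisfying \[ \mathit{Viable}_C(\vec{s}) \iff \forall \vec{i}'.\; A_T[\vec{s},\vec{i}']\Rightarrow \exists \vec{s}'.\; G_T[\vec{s},\vec{i}',\vec{s}']\land \mathit{Viable}_C(\vec{s}').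 \] Informally, these are the states from which $G_T$ can keep responding to valid inputs forever. -}

module Defs where

open import Data.Nat.Base using (ℕ; zero; suc)
open import Data.Product.Base using (Σ; Σ-syntax; ∃-syntax; _×_; _,_; proj₁; proj₂)
open import Data.Unit.Polymorphic.Base using (⊤; tt)
open import Data.Vec.Base using (Vec; foldr′)
open import Function.Bundles using (_⇔_; mk⇔)
open import Level using (Level) renaming (suc to lsuc)
open import Relation.Binary.PropositionalEquality.Core using (_≡_; refl)
open import Relation.Unary using (Pred; _⊆_)

private
  variable
    ℓ p : Level
    m n : ℕ
    σ : Vec (Set ℓ) m
    ι : Vec (Set ℓ) n

-- A vector of typed variables is given by the vector of their types; a
-- valuation is a tuple with one value of the prescribed type per variable.
-- (All over a vector of types would needlessly raise the universe level.)
Valuation : Vec (Set ℓ) n → Set ℓ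
Valuation = foldr′ _×_ ⊤

-- Predicates are arbitrary relations on valuations; no formula syntax is
-- fixed.  Arguments are always in the order s, i′, s′.
record TransitionSystem {ℓ} {m n : ℕ} (σ : Vec (Set ℓ) m) (ι : Vec (Set ℓ) n) : Set (lsuc ℓ) where
  field
    I : Valuation σ → Valuation ι → Set ℓ
    T : Valuation σ → Valuation ι → Valuation σ → Set ℓ

record Assumption {ℓ} {m n : ℕ} (σ : Vec (Set ℓ) m) (ι : Vec (Set ℓ) n) : Set (lsuc ℓ) where
  field
    A-I : Valuation ι → Set ℓ
    A-T : Valuation σ → Valuation ι → Set ℓ

record Contract {ℓ} {m n : ℕ} (σ : Vec (Set ℓ) m) (ι : Vec (Set ℓ) n) : Set (lsuc ℓ) where
  field
    A : Assumption σ ι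
    G : TransitionSystem σ ι
  open Assumption A public
  open TransitionSystem G public renaming (I to G-I; T to G-T)

module _ {ℓ} {m n : ℕ} {σ : Vec (Set ℓ) m} {ι : Vec (Set ℓ) n}
         (S : TransitionSystem σ ι) (A : Assumption σ ι) where
  open TransitionSystem S
  open Assumption A

  data Reachable : Pred (Valuation σ) ℓ where
    initial : ∀ {s i₀} → A-I i₀ → I s i₀ → Reachable s
    next    : ∀ {sₚ i′ s} → Reachable sₚ → A-T sₚ i′ → T sₚ i′ s → Reachable s

  record InputEnabled : Set ℓ where
    field
      enabled-I : ∀ i → A-I i → ∃[ s ] I s i
      enabled-T : ∀ s i′ → Reachable s → A-T s i′ → ∃[ s′ ] T s i′ s′

record Satisfies {ℓ} {m n : ℕ} {σ : Vec (Set ℓ) m} {ι : Vec (Set ℓ) n}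
                 (S : TransitionSystem σ ι) (C : Contract σ ι) : Set ℓ where
  open TransitionSystem S
  open Contract C
  field
    guarantee-I : ∀ s i → A-I i → I s i → G-I s i
    guarantee-T : ∀ s i′ s′ → Reachable S A s → A-T s i′ → T s i′ s′ → G-T s i′ s′

IsRealization : TransitionSystem σ ι → Contract σ ι → Set _
IsRealization S C = Satisfies S C × InputEnabled S (Contract.A C)

Realizable : Contract σ ι → Set _
Realizable {σ = σ} {ι = ι} C = Σ[ S ∈ TransitionSystem σ ι ] IsRealization S C

-- The right-hand side of the equivalence that defines viability.
CanRespond : Contract σ ι → Pred (Valuation σ) p → Pred (Valuation σ) _
CanRespond C X s = ∀ i′ → A-T s i′ → ∃[ s′ ] (G-T s i′ s′ × X s′)
  where open Contract C

-- The greatest fixed point of CanRespond C, as the union of all sets X with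
-- X ⊆ CanRespond C X.  Since X ranges over predicates of level ℓ, the union
-- lives one level up; viable-⇔ and viable-greatest show that it is
-- nevertheless a fixed point and the greatest one, at every level.
Viable : {σ : Vec (Set ℓ) m} {ι : Vec (Set ℓ) n} → Contract σ ι → Pred (Valuation σ) (lsuc ℓ)
Viable {ℓ = ℓ} {σ = σ} C s = Σ[ X ∈ Pred (Valuation σ) ℓ ] (X ⊆ CanRespond C X × X s)

viable-greatest : (C : Contract σ ι) (X : Pred (Valuation σ) p) →
                  X ⊆ CanRespond C X → X ⊆ Viable C
viable-greatest {σ = σ} C X post {s₀} x₀ =
  (λ s → Σ[ k ∈ ℕ ] Σ[ ν ∈ proj₁ (plays k) ] proj₁ (proj₂ (plays k) ν) ≡ s)
  , (λ { (k , ν , refl) i′ a →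
         let s′ , g , _ = post (proj₂ (proj₂ (plays k) ν)) i′ a
         in s′ , g , suc k , (ν , i′ , a) , refl })
  , zero , tt , refl
  where
  open Contract C
  -- Length-k input sequences valid along the responses chosen by post, each
  -- with the state it leads to.  They form a type of level ℓ whatever the
  -- level of X is.
  plays : ℕ → Σ[ N ∈ Set _ ] (N → Σ (Valuation σ) X)
  plays zero    = ⊤ , λ _ → s₀ , x₀
  plays (suc k) =
    let N , at = plays k in
    (Σ[ ν ∈ N ] ∃[ i′ ] A-T (proj₁ (at ν)) i′) ,
    λ (ν , i′ , a) → let s′ , _ , x′ = post (proj₂ (at ν)) i′ a in s′ , x′

viable-⇔ : (C : Contract σ ι) → ∀ s → Viable C s ⇔ CanRespond C (Viable C) s
viable-⇔ C s = mk⇔ unfold (λ r → viable-greatest C (CanRespond C (Viable C)) resp r)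
  where
  unfold : Viable C ⊆ CanRespond C (Viable C)
  unfold (X , post , x) i′ a =
    let s′ , g , x′ = post x i′ a in s′ , g , X , post , x′

  resp : CanRespond C (Viable C) ⊆ CanRespond C (CanRespond C (Viable C))
  resp r i′ a = let s′ , g , v = r i′ a in s′ , g , unfold v

{-# OPTIONS --safe #-}

-- For a realization, the reachable states form a post-fixed point of
-- CanRespond, so they are viable.  Conversely, Viable itself lives one level
-- too high to occur in a transition system, but the hypothesis supplies one
-- small post-fixed point per valid initial input; their union W is small and
-- post-fixed, and restricting G to states in W gives a realization.
module Submission where

open import Data.Nat.Base using (ℕ)
open import Data.Product.Base using (Σ-syntax; ∃-syntax; _×_; _,_; proj₁; proj₂)
open import Data.Vec.Base using (Vec)
open import Function.Bundles using (_⇔_; mk⇔)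
open import Level using (Level)
open import Relation.Unary using (Pred; _⊆_)
open import Defs

module _ {ℓ : Level} {m n : ℕ} {σ : Vec (Set ℓ) m} {ι : Vec (Set ℓ) n} (C : Contract σ ι) where
  open Contract C

  -- Input-enabledness supplies a response, satisfaction turns its `T` step into a `G-T` step, and
  -- `next` keeps it reachable.
  reachable-canRespond : (S : TransitionSystem σ ι) → IsRealization S C →
                         Reachable S A ⊆ CanRespond C (Reachable S A)
  reachable-canRespond S (sat , en) {s} r i′ a =
    let s′ , t = InputEnabled.enabled-T en s i′ r a
    in s′ , Satisfies.guarantee-T sat s i′ s′ r a t , next r a t

  realizable⇒viable : Realizable C → ∀ i → A-I i → ∃[ s ] (G-I s i × Viable C s)
  realizable⇒viable (S , real@(sat , en)) i a =
    let s , init = InputEnabled.enabled-I en i a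
    in s , Satisfies.guarantee-I sat s i a init
         , Reachable S A , reachable-canRespond S real , initial a init

  -- `T` constrains only the target of a step: a reachable source is initial or itself a target, so
  -- it lies in `W` already.
  restrict : Pred (Valuation σ) ℓ → TransitionSystem σ ι
  restrict W = record
    { I = λ s i → G-I s i × W s
    ; T = λ s i′ s′ → G-T s i′ s′ × W s′
    }

  reachable-restrict : (W : Pred (Valuation σ) ℓ) → Reachable (restrict W) A ⊆ W
  reachable-restrict W (initial _ (_ , w)) = w
  reachable-restrict W (next _ _ (_ , w))  = w

  restrict-isRealization : (W : Pred (Valuation σ) ℓ) → W ⊆ CanRespond C W →
                           (∀ i → A-I i → ∃[ s ] (G-I s i × W s)) →
                           IsRealization (restrict W) C
  restrict-isRealization W post start =
    record
      { guarantee-I = λ _ _ _ → proj₁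
      ; guarantee-T = λ _ _ _ _ _ → proj₁
      } ,
    record
      { enabled-I = start
      ; enabled-T = λ _ i′ r → post (reachable-restrict W r) i′
      }

  viable⇒realizable : (∀ i → A-I i → ∃[ s ] (G-I s i × Viable C s)) → Realizable C
  viable⇒realizable h = restrict W , restrict-isRealization W post start
    where
    witness : ∀ i → A-I i → Pred (Valuation σ) ℓ
    witness i a = proj₁ (proj₂ (proj₂ (h i a)))

    -- The proof `a` is an index too, since the set chosen by `h` may depend on it. Both indices
    -- range over types of level `ℓ`, so `W` stays at level `ℓ`.
    W : Pred (Valuation σ) ℓ
    W s = ∃[ i ] Σ[ a ∈ A-I i ] witness i a s

    post : W ⊆ CanRespond C W
    post (i , a , x) i′ a′ =
      -- The response stays in the same member of the union, so `i` and `a` are kept.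
      let _ , _ , _ , postᵢ , _ = h i a
          s′ , g , x′ = postᵢ x i′ a′
      in s′ , g , i , a , x′

    start : ∀ i → A-I i → ∃[ s ] (G-I s i × W s)
    start i a =
      let s , g , _ , _ , x = h i a
      in s , g , i , a , x

theorem1 : ∀ {ℓ : Level} {m n : ℕ} (σ : Vec (Set ℓ) m) (ι : Vec (Set ℓ) n) (C : Contract σ ι) →
    Realizable C ⇔ (∀ i → Contract.A-I C i → ∃[ s ] (Contract.G-I C s i × Viable C s))
theorem1 σ ι C = mk⇔ (realizable⇒viable C) (viable⇒realizable C)
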